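{- Let $\Sigma$ be a finite alphabet. Suppose a language $L\subseteq\Sigma^\omega$ can be expressed in the form $\Sigma^*(SR)^\omega$, where $S\subseteq\Sigma$, and $R\subseteq(\Sigma\setminus S)^*$ is a subword-closed regular language with totally ordered residuals. Then $L$ is prefix-independent and (edge-labelled) positional.
   Context: **Languages.** $L$ is prefix-independent if for all $x\in\Sigma^\omega$, $u\in\Sigma^*$: $x\in L\iff ux\in L$. For finite words, $u\le_{SUB}v$ means that $u$ is a (scattered) subword of $v$: there are indices $k_1<k_2<\dots<k_{|u|}$ with $v[k_1]v[k_2]\cdots v[k_{|u|}]=u$. $R$ is subword-closed if $v\in R$ and $u\le_{SUB}v$ imply $u\in R$. $R$ has totally ordered residuals if the sets $R_R(u)=\{v\mid uv\in R\}$ (for finite words $u$, with $v$ ranging over finite words) are totally ordered by inclusion. $SR$ denotes the concatenation $\{sr\mid s\in S,r\in R\}$. **Games.** An edge-labelled arena is a tuple $(V_1,V_2,\delta)$ where $V_1,V_2$ are disjoint finite sets of states controlled by Player 1 and Player 2, $V=V_1\sqcup V_2$, and $\delta\subseteq V\times\Sigma\times V$ is total (every state has at least one outgoing edge). For $e=(v,c,v')\in\delta$ write $src(e)=v$, $col(e)=c$, $tgt(e)=v'$. A strategy is a function $\sigma:V\cup\delta^+\to\delta$ with $src(\sigma(v))=v$ for $v\in V$ and $src(\sigma(we))=tgt(e)$ for $w\in\delta^*$, $e\in\delta$. A positional strategy is a function $\sigma:V\to\delta$ with $src(\sigma(v))=v$. Strategies $\sigma_1,\sigma_2$ and an initial state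 $q$ determine a play $\varsigma\in\delta^\omega$: if the current state lies in $V_i$, the next edge is given by $\sigma_i$ applied to the history of edges so far (to $q$ at the first step; to the current state if $\sigma_i$ is positional). Its trace is $col(\varsigma[0])col(\varsigma[1])\cdots\in\Sigma^\omega$. A strategy $\sigma_1$ is winning for Player 1 from $q$ with objective $L$ if for every strategy $\sigma_2$ the trace of the play from $q$ lies in $L$. **Positionality.** $L$ is (edge-labelled) positional if for every edge-labelled arena, every $W\subseteq V$, and every strategy that is winning for Player 1 (objective $L$) from all states of $W$, there is a single positional strategy that is winning for Player 1 from all states of $W$. -}

module Defs where

open import Data.Bool.Base using (Bool; T)
open import Data.Fin.Base using (Fin)
open import Data.Fin.Subset using (Subset; _∈_; _∉_)
open import Data.List.Base using (List; []; _∷_; _++_; [_]; foldl; applyUpTo)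
open import Data.List.Relation.Binary.Sublist.Propositional using ()
  renaming (_⊆_ to _≤SUB_)
open import Data.List.Relation.Unary.All using (All)
open import Data.Nat.Base using (ℕ; zero; suc; _+_; _∸_; _<_)
open import Data.Product.Base using (Σ-syntax; ∃-syntax; ∃₂; _×_)
open import Data.Sum.Base using (_⊎_; inj₁; inj₂)
open import Function.Bundles using (_⇔_)
open import Level using (0ℓ)
open import Relation.Binary.Definitions using (Total)
open import Relation.Binary.PropositionalEquality using (_≡_; _≗_)
open import Relation.Unary using (Pred; _⊆_)

ωWord : Set → Set
ωWord A = ℕ → A

Lang : Set → Set₁
Lang A = Pred (List A) 0ℓ

ωLang : Set → Set₁
ωLang A = Pred (ωWord A) 0ℓ

module _ {A : Set} where

  infixr 5 _++ω_
  infixr 6 _·_ _·ω_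
  infix  8 _^ω

  _++ω_ : List A → ωWord A → ωWord A
  ([]      ++ω x) n       = x n
  ((a ∷ u) ++ω x) zero    = a
  ((a ∷ u) ++ω x) (suc n) = (u ++ω x) n

  -- The factor x[i] x[i+1] ⋯ x[j-1].
  factor : ωWord A → ℕ → ℕ → List A
  factor x i j = applyUpTo (λ m → x (i + m)) (j ∸ i)

  _·_ : Lang A → Lang A → Lang A
  (P · Q) w = ∃₂ λ u v → P u × Q v × w ≡ u ++ v

  _·ω_ : Lang A → ωLang A → ωLang A
  (P ·ω X) x = ∃₂ λ u y → P u × X y × x ≗ u ++ω y

  -- x is cut at the positions 0 = f 0 < f 1 < f 2 < ⋯ into words of P.
  _^ω : Lang A → ωLang A
  (P ^ω) x = Σ[ f ∈ (ℕ → ℕ) ] f 0 ≡ 0 ×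
    (∀ i → f i < f (suc i) × P (factor x (f i) (f (suc i))))

  PrefixIndependent : ωLang A → Set
  PrefixIndependent L = ∀ x u → L x ⇔ L (u ++ω x)

  SubwordClosed : Lang A → Set
  SubwordClosed R = ∀ u v → R v → u ≤SUB v → R u

  residual : Lang A → List A → Lang A
  residual R u v = R (u ++ v)

  TotallyOrderedResiduals : Lang A → Set
  TotallyOrderedResiduals R = Total (λ u v → residual R u ⊆ residual R v)

record DFA (A : Set) : Set where
  field
    states : ℕ
    start  : Fin states
    step   : Fin states → A → Fin states
    final  : Subset states

  Accepts : Lang A
  Accepts w = foldl step start w ∈ final

Regular : {A : Set} → Lang A → Set
Regular {A} R = ∃[ M ] ∀ w → R w ⇔ DFA.Accepts {A} M w

letters : ∀ {k} → Subset k → Lang (Fin k)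
letters S w = ∃[ a ] a ∈ S × w ≡ [ a ]

_⊆[∁_]* : ∀ {k} → Lang (Fin k) → Subset k → Set
R ⊆[∁ S ]* = ∀ w → R w → All (_∉ S) w

record Arena (A : Set) : Set where
  field
    n₁ n₂ : ℕ

  V : Set
  V = Fin n₁ ⊎ Fin n₂

  -- δ is Bool-valued so that a triple (v , c , v′) gives at most one edge.
  field
    δ     : V → A → V → Bool
    total : ∀ v → ∃₂ λ c v′ → T (δ v c v′)

  record Edge : Set where
    constructor edge
    field
      src : V
      col : A
      tgt : V
      mem : T (δ src col tgt)

  open Edge public

  -- A strategy σ : V ∪ δ⁺ → δ is split into its values σ(v) = first v and
  -- σ(we) = next w e, where the history we ∈ δ⁺ is in chronological order.
  record Strategy : Set where
    field
      first     : V → Edge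
      next      : List Edge → Edge → Edge
      src-first : ∀ v → src (first v) ≡ v
      src-next  : ∀ w e → src (next w e) ≡ tgt e

  open Strategy public

  record PositionalStrategy : Set where
    field
      choose     : V → Edge
      src-choose : ∀ v → src (choose v) ≡ v

  open PositionalStrategy public

  toStrategy : PositionalStrategy → Strategy
  toStrategy p = record
    { first     = choose p
    ; next      = λ _ e → choose p (tgt e)
    ; src-first = src-choose p
    ; src-next  = λ _ e → src-choose p (tgt e)
    }

  byOwner : V → Edge → Edge → Edge
  byOwner (inj₁ _) e₁ e₂ = e₁
  byOwner (inj₂ _) e₁ e₂ = e₂

  mutual

    play : Strategy → Strategy → V → ℕ → Edge
    play σ₁ σ₂ q zero    = byOwner q (first σ₁ q) (first σ₂ q)
    play σ₁ σ₂ q (suc n) =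
      let w = history σ₁ σ₂ q n
          e = play σ₁ σ₂ q n
      in byOwner (tgt e) (next σ₁ w e) (next σ₂ w e)

    -- The first n edges of the play.
    history : Strategy → Strategy → V → ℕ → List Edge
    history σ₁ σ₂ q zero    = []
    history σ₁ σ₂ q (suc n) = history σ₁ σ₂ q n ++ [ play σ₁ σ₂ q n ]

  trace : Strategy → Strategy → V → ωWord A
  trace σ₁ σ₂ q n = col (play σ₁ σ₂ q n)

  Winning : ωLang A → Strategy → V → Set
  Winning L σ₁ q = ∀ σ₂ → L (trace σ₁ σ₂ q)

Positional : {A : Set} → ωLang A → Set₁
Positional {A} L = (G : Arena A) → let open Arena G in
  (W : Pred V 0ℓ) (σ : Strategy) → (∀ q → W q → Winning L σ q) →
  ∃[ p ] ∀ q → W q → Winning L (toStrategy p) q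

{-# OPTIONS --safe #-}

-- A word lies in L iff S occurs infinitely often and, from some point on, the
-- word read since the last occurrence of S stays in R.  Given σ, the region Y
-- won by a positional strategy is enlarged until it contains every state from
-- which σ wins.  If σ wins somewhere outside Y, then after some history no
-- continuation avoiding Y leaves R any more: otherwise a play avoiding Y would
-- leave R infinitely often.  From such histories σ reaches S or Y within a
-- bounded number of steps, as arenas are finitely branching.  At each state
-- outside Y visited by such a history, play the move of σ after the history
-- minimizing first the residual of the word since the last S and then this
-- bound.  By subword-closure a letter outside S never enlarges the residual, so
-- the pair decreases lexicographically until S or Y is reached; and the word
-- really read always has a larger residual than the one of the history that is
-- imitated, so it stays in R.
module Submission where

open import Defs
open import Axiom.ExcludedMiddle using (ExcludedMiddle)
open import Data.Bool.Properties using (T-irrelevant)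
open import Data.Empty using (⊥)
open import Data.Fin.Base using (Fin)
open import Data.Fin.Subset using (Subset; _∈_; _∉_)
open import Data.Fin.Subset.Properties using (_∈?_)
open import Data.List.Base
  using (List; []; _∷_; _++_; [_]; length; filter; foldl; map; applyUpTo; allFin; cartesianProduct)
import Data.List.Membership.Propositional as List
open import Data.List.Membership.Propositional.Properties
  using (∈-allFin; ∈-map⁺; ∈-++⁺ˡ; ∈-++⁺ʳ; ∈-cartesianProduct⁺)
open import Data.List.Properties using (++-assoc; ++-identityʳ; applyUpTo-∷ʳ; foldl-++; length-++)
open import Data.List.Relation.Binary.Sublist.Propositional
  using (_∷_; _∷ʳ_; minimum; ⊆-refl) renaming (_⊆_ to _≤SUB_)
open import Data.List.Relation.Binary.Sublist.Propositional.Properties using (++⁺)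
open import Data.List.Relation.Unary.All as All using (All; []; _∷_)
open import Data.List.Relation.Unary.All.Properties using (applyUpTo⁻)
import Data.List.Relation.Unary.Any as Any
open import Data.Nat.Base using (ℕ; zero; suc; _+_; _∸_; _≤_; _<_; _⊔_; z≤n; s≤s)
open import Data.Nat.Induction using (<-wellFounded)
open import Data.Nat.Properties
open import Data.Product.Base using (Σ-syntax; ∃-syntax; _×_; _,_; proj₁; proj₂)
open import Data.Product.Relation.Binary.Lex.Strict
  using (×-Lex; ×-wellFounded; ×-compare; ×-transitive)
open import Data.Sum.Base using (inj₁; inj₂)
open import Data.Unit.Base using (⊤; tt)
open import Function.Base using (_∘_)
open import Function.Bundles using (mk⇔; Equivalence)
open import Induction.WellFounded using (WellFounded; Acc; acc)
open import Level using (0ℓ)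
open import Relation.Binary.Core using (Rel)
open import Relation.Binary.Definitions using (tri<; tri≈; tri>)
open import Relation.Binary.PropositionalEquality
  using (_≡_; _≗_; refl; sym; trans; cong; cong₂; subst; resp₂; isEquivalence; module ≡-Reasoning)
open import Relation.Nullary using (¬_; Dec; yes; no; contradiction)
open import Relation.Nullary.Decidable using (decidable-stable)
open import Relation.Unary using (Pred; U; _≐_; _⊆_; ∁; _∪_)

-- Counting with excluded middle, and the rank of residuals.

module Counting (em : ExcludedMiddle 0ℓ) {A : Set} where

  count : Pred A 0ℓ → List A → ℕ
  count P = length ∘ filter (λ a → em {P a})

  count-mono : ∀ {P Q} → P ⊆ Q → ∀ xs → count P xs ≤ count Q xs
  count-mono         P⊆Q []       = z≤n
  count-mono {P} {Q} P⊆Q (x ∷ xs) with em {P x} | em {Q x}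
  ... | yes p | yes q = s≤s (count-mono P⊆Q xs)
  ... | yes p | no ¬q = contradiction (P⊆Q p) ¬q
  ... | no ¬p | yes q = m≤n⇒m≤1+n (count-mono P⊆Q xs)
  ... | no ¬p | no ¬q = count-mono P⊆Q xs

  count-strict : ∀ {P Q a xs} → P ⊆ Q → a List.∈ xs → ¬ P a → Q a →
    count P xs < count Q xs
  count-strict {P} {Q} {a} {_ ∷ xs} P⊆Q (Any.here refl) ¬p q with em {P a} | em {Q a}
  ... | yes p | _     = contradiction p ¬p
  ... | no _  | yes _ = s≤s (count-mono P⊆Q xs)
  ... | no _  | no ¬q = contradiction q ¬q
  count-strict {P} {Q} {a} {x ∷ xs} P⊆Q (Any.there a∈xs) ¬p q with em {P x} | em {Q x}
  ... | yes _ | yes _ = s≤s (count-strict P⊆Q a∈xs ¬p q)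
  ... | yes p | no ¬q = contradiction (P⊆Q p) ¬q
  ... | no _  | yes _ = m≤n⇒m≤1+n (count-strict P⊆Q a∈xs ¬p q)
  ... | no _  | no _  = count-strict P⊆Q a∈xs ¬p q

-- Numbers the totally ordered residuals: rank u counts the automaton states
-- reached by some word whose residual is contained in that of u.
module Rank (em : ExcludedMiddle 0ℓ) {A : Set} {R : Lang A}
  (regular : Regular R) (residuals-total : TotallyOrderedResiduals R) where

  open Counting em
  open DFA (proj₁ regular)

  infix 4 _⊑_

  _⊑_ : List A → List A → Set
  u ⊑ v = residual R u ⊆ residual R v

  run : List A → Fin states
  run = foldl step start

  -- Acceptance of `u ++ w` depends on `u` only through the state it reaches.
  run≡⇒⊑ : ∀ {u v} → run u ≡ run v → u ⊑ v
  run≡⇒⊑ {u} {v} eq {w} r = from (proj₂ regular (v ++ w))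
    (subst (_∈ final) step≡ (to (proj₂ regular (u ++ w)) r))
    where
    open Equivalence
    step≡ : run (u ++ w) ≡ run (v ++ w)
    step≡ = trans (foldl-++ step start u w)
      (trans (cong (λ d → foldl step d w) eq) (sym (foldl-++ step start v w)))

  Below : List A → Pred (Fin states) 0ℓ
  Below u d = ∃[ u′ ] run u′ ≡ d × u′ ⊑ u

  rank : List A → ℕ
  rank u = count (Below u) (allFin states)

  ⊑⇒rank≤ : ∀ {u v} → u ⊑ v → rank u ≤ rank v
  ⊑⇒rank≤ u⊑v = count-mono (λ { (u′ , eq , u′⊑u) → u′ , eq , u⊑v ∘ u′⊑u }) (allFin states)

  -- If the inclusion fails, totality gives the strict reverse one. Then the state reached by `u` is
  -- counted for `u` but not for `v`, since every word reaching it has the residual of `u`.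
  rank≤⇒⊑ : ∀ {u v} → rank u ≤ rank v → u ⊑ v
  rank≤⇒⊑ {u} {v} u≤v with residuals-total u v | em {u ⊑ v}
  ... | inj₁ u⊑v | _       = u⊑v
  ... | inj₂ _   | yes u⊑v = u⊑v
  ... | inj₂ v⊑u | no u⋢v  = contradiction u≤v (<⇒≱ (count-strict
    (λ { (u′ , eq , u′⊑v) → u′ , eq , v⊑u ∘ u′⊑v })
    (∈-allFin (run u))
    (λ { (u′ , eq , u′⊑v) → u⋢v (u′⊑v ∘ run≡⇒⊑ {u} {u′} (sym eq)) })
    (u , refl , λ {_} r → r)))

-- The word read since the last letter of `S`.

module Words {k : ℕ} (S : Subset k) where

  push : List (Fin k) → Fin k → List (Fin k)
  push u c with c ∈? S
  ... | yes _ = []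
  ... | no _  = u ++ [ c ]

  push-∈ : ∀ {u c} → c ∈ S → push u c ≡ []
  push-∈ {c = c} c∈S with c ∈? S
  ... | yes _   = refl
  ... | no c∉S = contradiction c∈S c∉S

  push-∉ : ∀ {u c} → c ∉ S → push u c ≡ u ++ [ c ]
  push-∉ {c = c} c∉S with c ∈? S
  ... | yes c∈S = contradiction c∈S c∉S
  ... | no _    = refl

  -- The seed `u` stands for what was read since the last letter of `S` before `x` begins; the first
  -- letter of `S` in `x` erases it.
  scan : List (Fin k) → ωWord (Fin k) → ℕ → List (Fin k)
  scan u x zero    = u
  scan u x (suc t) = push (scan u x t) (x t)

  scan-cong : ∀ {u x y} → x ≗ y → scan u x ≗ scan u y
  scan-cong x≗y zero    = refl
  scan-cong x≗y (suc t) = cong₂ push (scan-cong x≗y t) (x≗y t)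

  scan-+ : ∀ u x s t → scan u x (s + t) ≡ scan (scan u x s) (λ i → x (s + i)) t
  scan-+ u x s zero    = cong (scan u x) (+-identityʳ s)
  scan-+ u x s (suc t) = trans (cong (scan u x) (+-suc s t))
    (cong (λ w → push w (x (s + t))) (scan-+ u x s t))

  scan-∉ : ∀ u x t → (∀ {i} → i < t → x i ∉ S) → scan u x t ≡ u ++ applyUpTo x t
  scan-∉ u x zero    _  = sym (++-identityʳ u)
  scan-∉ u x (suc t) ∉S = begin
    push (scan u x t) (x t)          ≡⟨ push-∉ (∉S ≤-refl) ⟩
    scan u x t ++ [ x t ]            ≡⟨ cong (_++ [ x t ]) (scan-∉ u x t (∉S ∘ m≤n⇒m≤1+n)) ⟩
    (u ++ applyUpTo x t) ++ [ x t ]  ≡⟨ ++-assoc u (applyUpTo x t) [ x t ] ⟩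
    u ++ (applyUpTo x t ++ [ x t ])  ≡⟨ cong (u ++_) (applyUpTo-∷ʳ x t) ⟩
    u ++ applyUpTo x (suc t)         ∎
    where open ≡-Reasoning

  scan-block : ∀ u x s t → x s ∈ S → (∀ {i} → i < t → x (s + suc i) ∉ S) →
    scan u x (s + suc t) ≡ applyUpTo (λ i → x (s + suc i)) t
  scan-block u x s t s∈S ∉S = begin
    scan u x (s + suc t)                    ≡⟨ cong (scan u x) (+-suc s t) ⟩
    scan u x (suc s + t)                    ≡⟨ scan-+ u x (suc s) t ⟩
    scan (push (scan u x s) (x s)) x′ t     ≡⟨ cong (λ v → scan v x′ t) (push-∈ s∈S) ⟩
    scan [] x′ t                            ≡⟨ scan-cong (λ i → cong x (sym (+-suc s i))) t ⟩
    scan [] (λ i → x (s + suc i)) t         ≡⟨ scan-∉ [] _ t ∉S ⟩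
    applyUpTo (λ i → x (s + suc i)) t       ∎
    where
    open ≡-Reasoning
    x′ = λ i → x (suc s + i)

  Recurrent : Pred (ωWord (Fin k)) 0ℓ
  Recurrent x = ∀ t → ∃[ d ] x (t + d) ∈ S

  first-∈ : ∀ (x : ωWord (Fin k)) d → x d ∈ S → ∃[ m ] x m ∈ S × (∀ {i} → i < m → x i ∉ S)
  first-∈ x d       xd∈S with x 0 ∈? S
  first-∈ x d       xd∈S | yes x0∈S = 0 , x0∈S , λ ()
  first-∈ x zero    xd∈S | no x0∉S  = contradiction xd∈S x0∉S
  first-∈ x (suc d) xd∈S | no x0∉S  with first-∈ (x ∘ suc) d xd∈S
  ... | m , xm∈S , ∉S = suc m , xm∈S , λ { {zero} _ → x0∉S ; {suc i} (s≤s i<m) → ∉S i<m }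

-- Membership in `L` in terms of scans, and prefix-independence.

module Language {k : ℕ} (S : Subset k) (R : Lang (Fin k))
  (R⊆ : R ⊆[∁ S ]*) (closed : SubwordClosed R)
  (L : ωLang (Fin k)) (L≐ : L ≐ U ·ω (letters S · R) ^ω) where

  open Words S

  private
    Γ : Set
    Γ = Fin k

  L-cons : ∀ x → L (x ∘ suc) → L x
  L-cons x l with proj₁ L≐ l
  ... | u , y , _ , y∈ , eq = proj₂ L≐
    (x 0 ∷ u , y , _ , y∈ , λ { zero → refl ; (suc n) → eq n })

  L-drop : ∀ t x → L (λ i → x (t + i)) → L x
  L-drop zero    x l = l
  L-drop (suc t) x l = L-cons x (L-drop t (x ∘ suc) l)

  -- Cut right in front of each letter of `S`. The hypothesis starts at `suc t` because at time 0
  -- the scan is still the arbitrary seed.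
  cuts⇒L : ∀ y → y 0 ∈ S → Recurrent y → (∀ u t → R (scan u y (suc t))) → L y
  cuts⇒L y y0∈S rec scans = proj₂ L≐ ([] , y , _ , (cut , refl , block) , λ _ → refl)
    where
    gap : ∀ s → ∃[ m ] y (suc s + m) ∈ S × (∀ {i} → i < m → y (suc s + i) ∉ S)
    gap s = first-∈ (λ i → y (suc s + i)) (proj₁ (rec (suc s))) (proj₂ (rec (suc s)))

    cut : ℕ → ℕ
    cut zero    = 0
    -- The gap counts the letters strictly between two letters of `S`; `suc` accounts for the first
    -- of the two.
    cut (suc i) = cut i + suc (proj₁ (gap (cut i)))

    cut-∈ : ∀ i → y (cut i) ∈ S
    cut-∈ zero    = y0∈S
    cut-∈ (suc i) = subst (λ n → y n ∈ S) (sym (+-suc (cut i) _)) (proj₁ (proj₂ (gap (cut i))))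

    block : ∀ i → cut i < cut (suc i) × (letters S · R) (factor y (cut i) (cut (suc i)))
    block i = m<m+n (cut i) (s≤s z≤n) , [ y (s + 0) ] , applyUpTo (λ j → y (s + suc j)) m ,
      (y (s + 0) , subst (λ n → y n ∈ S) (sym (+-identityʳ s)) (cut-∈ i) , refl) ,
      subst R (scan-block [] y s m (cut-∈ i)
        (λ {j} j<m → subst (λ n → y n ∉ S) (sym (+-suc s j)) (proj₂ (proj₂ (gap s)) j<m)))
        (subst (R ∘ scan [] y) (sym (+-suc s m)) (scans [] (s + m))) ,
      cong (applyUpTo (λ j → y (s + j))) (m+n∸m≡n s (suc m))
      where
      s = cut i
      m = proj₁ (gap s)

  -- Drop everything before the first known letter of `S` from time `T` on. The rest begins with a
  -- letter of `S`, so its scans forget the seed and agree with those of `x`.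
  scan⇒L : ∀ x u T → Recurrent x → (∀ t → R (scan u x (T + t))) → L x
  scan⇒L x u T rec scans = L-drop (T + d) x (cuts⇒L y y0∈S rec′ scans′)
    where
    d = proj₁ (rec T)
    y = λ i → x (T + d + i)
    y0∈S : y 0 ∈ S
    y0∈S = subst (λ n → x n ∈ S) (sym (+-identityʳ (T + d))) (proj₂ (rec T))
    rec′ : Recurrent y
    rec′ t with rec (T + d + t)
    ... | e , ∈S = e , subst (λ n → x n ∈ S) (+-assoc (T + d) t e) ∈S
    scan-y : ∀ v w t → scan v y (suc t) ≡ scan w y (suc t)
    scan-y v w zero    = trans (push-∈ y0∈S) (sym (push-∈ y0∈S))
    scan-y v w (suc t) = cong (λ z → push z (y (suc t))) (scan-y v w t)
    scans′ : ∀ v t → R (scan v y (suc t))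
    scans′ v t = subst R
      (trans (cong (scan u x) (sym (+-assoc T d (suc t))))
        (trans (scan-+ u x (T + d) (suc t)) (scan-y _ v t)))
      (scans (d + suc t))

  module _ (y : ωWord Γ) (f : ℕ → ℕ) (f0 : f 0 ≡ 0)
    (blocks : ∀ i → f i < f (suc i) × (letters S · R) (factor y (f i) (f (suc i)))) where

    locate : ∀ t → ∃[ i ] ∃[ m ] t ≡ f i + m × f i + m < f (suc i)
    locate zero = 0 , 0 , sym (trans (+-identityʳ (f 0)) f0) ,
      subst (_< f 1) (sym (+-identityʳ (f 0))) (proj₁ (blocks 0))
    locate (suc t) with locate t
    ... | i , m , refl , lt with m≤n⇒m<n∨m≡n lt
    ...   | inj₁ lt′ = i , suc m , sym (+-suc (f i) m) , subst (_< f (suc i)) (sym (+-suc (f i) m)) lt′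
    ...   | inj₂ eq  = suc i , 0 , trans eq (sym (+-identityʳ _)) ,
      subst (_< f (suc (suc i))) (sym (+-identityʳ _)) (proj₁ (blocks (suc i)))

    block-view : ∀ i → ∃[ n ] f (suc i) ≡ f i + suc n × y (f i) ∈ S ×
      R (applyUpTo (λ j → y (f i + suc j)) n)
    block-view i with f (suc i) ∸ f i in eq | blocks i
    ... | zero  | lt , _ = contradiction eq (m>n⇒m∸n≢0 lt)
    ... | suc n | lt , _ , r , (s , s∈S , refl) , r∈R , fac
      -- The factor has length `suc n`, so it computes to a cons, and matching on `fac` separates
      -- the letter of `S` from the word of `R`.
      with refl ← fac = n , trans (sym (m+[n∸m]≡n (<⇒≤ lt))) (cong (f i +_) eq) ,
        subst (λ n → y n ∈ S) (+-identityʳ (f i)) s∈S , r∈R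

    cuts⇒Recurrent : Recurrent y
    cuts⇒Recurrent t with locate t
    ... | i , m , refl , lt = f (suc i) ∸ (f i + m) ,
      subst (λ n → y n ∈ S) (sym (m+[n∸m]≡n (<⇒≤ lt))) (proj₁ (proj₂ (proj₂ (block-view (suc i)))))

    applyUpTo-≤SUB : ∀ (g : ℕ → Γ) {m n} → m ≤ n →
      applyUpTo g m ≤SUB applyUpTo g n
    applyUpTo-≤SUB g z≤n       = minimum _
    applyUpTo-≤SUB g (s≤s m≤n) = refl ∷ applyUpTo-≤SUB (g ∘ suc) m≤n

    -- Inside a block the scan is a prefix of the word of `R` in that block, hence a subword of it.
    -- By `R⊆` that word has no letter of `S`, so nothing is erased.
    cuts⇒scan : ∀ u t → R (scan u y (suc t))
    cuts⇒scan u t with locate t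
    ... | i , m , refl , lt with block-view i
    ...   | n , eq , ∈S , r = subst R
      (sym (trans (cong (scan u y) (sym (+-suc (f i) m)))
        (scan-block u y (f i) m ∈S (λ i<m → applyUpTo⁻ _ n (R⊆ _ r) (≤-trans i<m m≤n)))))
      (closed _ _ r (applyUpTo-≤SUB _ m≤n))
      where
      m≤n : m ≤ n
      m≤n = ≤-pred (+-cancelˡ-< (f i) m (suc n) (subst (f i + m <_) eq lt))

  private
    -- All seeds are allowed because prepending a letter to the word changes the seed.
    Good : Pred (ωWord Γ) 0ℓ
    Good x = Recurrent x × (∀ u → ∃[ T ] ∀ t → R (scan u x (T + t)))

    Good-≗ : ∀ {x y} → x ≗ y → Good y → Good x
    Good-≗ x≗y (rec , scans) =
      (λ t → proj₁ (rec t) , subst (_∈ S) (sym (x≗y _)) (proj₂ (rec t))) ,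
      (λ u → proj₁ (scans u) , λ t → subst R (sym (scan-cong x≗y (proj₁ (scans u) + t))) (proj₂ (scans u) t))

    scan-suc : ∀ u x t → scan u x (suc t) ≡ scan (push u (x 0)) (x ∘ suc) t
    scan-suc u x t = scan-+ u x 1 t

    Good-cons : ∀ x → Good (x ∘ suc) → Good x
    Good-cons x (rec , scans) = rec′ , λ u → suc (proj₁ (scans (push u (x 0)))) ,
      λ t → subst R (sym (scan-suc u x _)) (proj₂ (scans _) t)
      where
      rec′ : Recurrent x
      rec′ zero    = suc (proj₁ (rec 0)) , proj₂ (rec 0)
      rec′ (suc t) = rec t

    Good-++ω : ∀ u y → Good y → Good (u ++ω y)
    Good-++ω []      y g = g
    Good-++ω (c ∷ u) y g = Good-cons _ (Good-++ω u y g)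

  L⇒Recurrent×scan : ∀ x → L x → Recurrent x × (∀ u → ∃[ T ] ∀ t → R (scan u x (T + t)))
  L⇒Recurrent×scan x l with proj₁ L≐ l
  ... | u , y , _ , (f , f0 , blocks) , eq = Good-≗ eq (Good-++ω u y
    (cuts⇒Recurrent y f f0 blocks , λ v → 1 , cuts⇒scan y f f0 blocks v))

  -- The deleted letter may belong to the first block, so the decomposition itself does not restrict
  -- to the tail. The scan condition does, as it only concerns late times.
  L-tail : ∀ x → L x → L (x ∘ suc)
  L-tail x l with L⇒Recurrent×scan x l
  ... | rec , scans with scans []
  ...   | T , inR = scan⇒L (x ∘ suc) (push [] (x 0)) T (rec ∘ suc)
    (λ t → subst R (trans (cong (scan [] x) (+-suc T t)) (scan-suc [] x (T + t))) (inR (suc t)))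

  L-≗ : ∀ {x y} → x ≗ y → L x → L y
  L-≗ x≗y l with proj₁ L≐ l
  ... | u , z , _ , z∈ , eq = proj₂ L≐ (u , z , _ , z∈ , λ n → trans (sym (x≗y n)) (eq n))

  prefixIndependent : PrefixIndependent L
  prefixIndependent x u = mk⇔ (prepend u) (remove u)
    where
    prepend : ∀ u → L x → L (u ++ω x)
    prepend []      l = l
    prepend (c ∷ u) l = L-cons _ (prepend u l)
    remove : ∀ u → L (u ++ω x) → L x
    remove []      l = l
    remove (c ∷ u) l = remove u (L-tail _ l)

-- Uniform bounds, the lexicographic order and minimal elements.

bounded : {A : Set} (P : ℕ → A → Set) → (∀ {m n a} → m ≤ n → P m a → P n a) →
  ∀ {xs} → All (λ a → ∃[ m ] P m a) xs → ∃[ m ] All (P m) xs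
bounded P mono []              = 0 , []
bounded P mono ((m , p) ∷ pxs) with bounded P mono pxs
... | n , ps = m ⊔ n , mono (m≤m⊔n m n) p ∷ All.map (mono (m≤n⊔m m n)) ps

infix 4 _≺_

_≺_ : Rel (ℕ × ℕ) 0ℓ
_≺_ = ×-Lex _≡_ _<_ _<_

≺-wellFounded : WellFounded _≺_
≺-wellFounded = ×-wellFounded <-wellFounded <-wellFounded

≮-≺-trans : ∀ {x y z} → ¬ y ≺ x → y ≺ z → x ≺ z
≮-≺-trans {x} {y} {z} y⊀x y≺z with ×-compare sym <-cmp <-cmp x y
... | tri< x≺y _ _ = ×-transitive {_<₂_ = _<_} isEquivalence (resp₂ _<_) <-trans <-trans {x} {y} {z} x≺y y≺z
... | tri≈ _ (refl , refl) _ = y≺z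
... | tri> _ _ y≺x = contradiction y≺x y⊀x

module Minimum (em : ExcludedMiddle 0ℓ) where

  minimal : {K C : Set} {_<ᵏ_ : Rel K 0ℓ} → WellFounded _<ᵏ_ → (key : C → K) →
    C → Σ[ c ∈ C ] (∀ c′ → ¬ key c′ <ᵏ key c)
  minimal {_<ᵏ_ = _<ᵏ_} wf key c = go c (wf (key c))
    where
    go : ∀ c → Acc _<ᵏ_ (key c) → Σ[ c ∈ _ ] (∀ c′ → ¬ key c′ <ᵏ key c)
    go c (acc rs) with em {∃[ c′ ] key c′ <ᵏ key c}
    ... | yes (c′ , lt) = go c′ (rs lt)
    ... | no ¬lt        = c , λ c′ lt → ¬lt (c′ , lt)

-- Edges and plays of a positional strategy.

module ArenaFacts {A : Set} (G : Arena A) where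

  open Arena G

  Own₁ : V → Set
  Own₁ (inj₁ _) = ⊤
  Own₁ (inj₂ _) = ⊥

  byOwner-elim : (P : Edge → Set) → ∀ v {e₁ e₂} → P e₁ → P e₂ → P (byOwner v e₁ e₂)
  byOwner-elim P (inj₁ _) p₁ p₂ = p₁
  byOwner-elim P (inj₂ _) p₁ p₂ = p₂

  byOwner-Own₁ : ∀ v {e₁ e₂} → Own₁ v → byOwner v e₁ e₂ ≡ e₁
  byOwner-Own₁ (inj₁ _) _ = refl

  byOwner-≡ : ∀ v {e e₁ e₂} → (Own₁ v → e ≡ e₁) → e ≡ e₂ → byOwner v e₁ e₂ ≡ e
  byOwner-≡ (inj₁ _) eq₁ eq₂ = sym (eq₁ tt)
  byOwner-≡ (inj₂ _) eq₁ eq₂ = sym eq₂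

  allV : List V
  allV = map inj₁ (allFin n₁) ++ map inj₂ (allFin n₂)

  ∈-allV : ∀ v → v List.∈ allV
  ∈-allV (inj₁ i) = ∈-++⁺ˡ (∈-map⁺ inj₁ (∈-allFin i))
  ∈-allV (inj₂ i) = ∈-++⁺ʳ (map inj₁ (allFin n₁)) (∈-map⁺ inj₂ (∈-allFin i))

  someEdge : V → Edge
  someEdge v with total v
  ... | c , v′ , t = edge v c v′ t

  src-someEdge : ∀ v → src (someEdge v) ≡ v
  src-someEdge v with total v
  ... | c , v′ , t = refl

  Linked : (ℕ → Edge) → Set
  Linked ε = ∀ i → src (ε (suc i)) ≡ tgt (ε i)

  Consistent : PositionalStrategy → Edge → Set
  Consistent p e = Own₁ (src e) → e ≡ choose p (src e)

  module _ (p : PositionalStrategy) (σ₂ : Strategy) (q : V) where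

    private
      ε : ℕ → Edge
      ε = play (toStrategy p) σ₂ q

    play-src : src (ε 0) ≡ q
    play-src = byOwner-elim (λ e → src e ≡ q) q (src-choose p q) (src-first σ₂ q)

    play-linked : Linked ε
    play-linked i = byOwner-elim (λ e → src e ≡ tgt (ε i)) (tgt (ε i))
      (src-choose p (tgt (ε i))) (src-next σ₂ (history (toStrategy p) σ₂ q i) (ε i))

    play-consistent : ∀ i → Consistent p (ε i)
    play-consistent zero    o = trans (byOwner-Own₁ q (subst Own₁ play-src o))
      (cong (choose p) (sym play-src))
    play-consistent (suc i) o =
      trans (byOwner-Own₁ (tgt (ε i)) (subst Own₁ (play-linked i) o))
        (cong (choose p) (sym (play-linked i)))

-- Histories of `σ` and their continuations.

module Solve (em : ExcludedMiddle 0ℓ) {k : ℕ} (S : Subset k) (R : Lang (Fin k))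
  (R⊆ : R ⊆[∁ S ]*) (closed : SubwordClosed R)
  (regular : Regular R) (residuals-total : TotallyOrderedResiduals R)
  (L : ωLang (Fin k)) (L≐ : L ≐ U ·ω (letters S · R) ^ω)
  (G : Arena (Fin k)) (σ : Arena.Strategy G) where

  open Arena G
  open ArenaFacts G
  open Words S
  open Language S R R⊆ closed L L≐
  open Rank em regular residuals-total
  open Counting em
  open Minimum em

  push-mono : ∀ {u v} c → u ⊑ v → push u c ⊑ push v c
  push-mono {u} {v} c u⊑v {w} r with c ∈? S
  ... | yes _ = r
  ... | no _  = subst R (sym (++-assoc v [ c ] w)) (u⊑v (subst R (++-assoc u [ c ] w) r))

  -- Deleting `c` from `u ++ [ c ] ++ w` leaves a subword.
  push-⊑ : ∀ {u c} → c ∉ S → push u c ⊑ u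
  push-⊑ {u} {c} c∉S {w} r = closed (u ++ w) (u ++ [ c ] ++ w)
    (subst R (trans (cong (_++ w) (push-∉ c∉S)) (++-assoc u [ c ] w)) r)
    (++⁺ (⊆-refl {x = u}) (c ∷ʳ ⊆-refl))

  ⊑-R : ∀ {u v} → u ⊑ v → R u → R v
  ⊑-R {u} {v} u⊑v r = subst R (++-identityʳ v) (u⊑v (subst R (sym (++-identityʳ u)) r))

  -- Storing the next move as `plan` hides the split of `σ` into `first` and `next`, so the empty
  -- history needs no separate treatment.
  record Node : Set where
    field
      past     : List Edge
      here     : V
      plan     : Edge
      src-plan : src plan ≡ here
      since    : List (Fin k)

  open Node

  root : V → Node
  root q = record
    { past = [] ; here = q ; plan = first σ q ; src-plan = src-first σ q ; since = [] }

  ext : Node → Edge → Node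
  ext n e = record
    { past     = past n ++ [ e ]
    ; here     = tgt e
    ; plan     = next σ (past n) e
    ; src-plan = src-next σ (past n) e
    ; since    = push (since n) (col e)
    }

  Legit : Node → Edge → Set
  Legit n e = src e ≡ here n × (Own₁ (here n) → e ≡ plan n)

  record Path (n : Node) : Set where
    field
      edges      : ℕ → Edge
      nodes      : ℕ → Node
      nodes-zero : nodes 0 ≡ n
      nodes-suc  : ∀ i → nodes (suc i) ≡ ext (nodes i) (edges i)
      legit      : ∀ i → Legit (nodes i) (edges i)

    word : ωWord (Fin k)
    word i = col (edges i)

    scan-word : ∀ i → scan (since n) word i ≡ since (nodes i)
    scan-word zero    = cong since (sym nodes-zero)
    scan-word (suc i) = trans (cong (λ u → push u (word i)) (scan-word i))
      (cong since (sym (nodes-suc i)))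

  open Path

  Win : Node → Set
  Win n = ∀ (π : Path n) → L (word π)

  -- A path from `ext n e` becomes one from `n` by putting `e` in front; `L-tail` removes the
  -- additional letter.
  win-ext : ∀ {n e} → Legit n e → Win n → Win (ext n e)
  win-ext {n} {e} l win π = L-tail _ (win record
    { edges      = λ { zero → e ; (suc i) → edges π i }
    ; nodes      = λ { zero → n ; (suc i) → nodes π i }
    ; nodes-zero = refl
    ; nodes-suc  = λ { zero → nodes-zero π ; (suc i) → nodes-suc π i }
    ; legit      = λ { zero → l ; (suc i) → legit π i }
    })

  -- Turns a rule for choosing moves into an infinite path. An element of `X` is a node with the
  -- evidence from which its next move is chosen.
  module Iterate {X : Set} (node : X → Node) (move : X → Edge) (next-X : X → X)
    (move-legit : ∀ x → Legit (node x) (move x))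
    (node-next : ∀ x → node (next-X x) ≡ ext (node x) (move x)) where

    iter : ℕ → X → X
    iter zero    x = x
    iter (suc i) x = iter i (next-X x)

    iter-+ : ∀ i j x → iter (i + j) x ≡ iter j (iter i x)
    iter-+ zero    j x = refl
    iter-+ (suc i) j x = iter-+ i j (next-X x)

    node-iter-suc : ∀ i x → node (iter (suc i) x) ≡ ext (node (iter i x)) (move (iter i x))
    node-iter-suc zero    x = node-next x
    node-iter-suc (suc i) x = node-iter-suc i (next-X x)

    path : ∀ x → Path (node x)
    path x = record
      { edges      = λ i → move (iter i x)
      ; nodes      = λ i → node (iter i x)
      ; nodes-zero = refl
      ; nodes-suc  = λ i → node-iter-suc i x
      ; legit      = λ i → move-legit (iter i x)
      }

  private
    redirect : V → Edge → Edge
    redirect v e with em {src e ≡ v}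
    ... | yes _ = e
    ... | no _  = someEdge v

    src-redirect : ∀ v e → src (redirect v e) ≡ v
    src-redirect v e with em {src e ≡ v}
    ... | yes eq = eq
    ... | no _   = src-someEdge v

    redirect-≡ : ∀ {v e} → src e ≡ v → redirect v e ≡ e
    redirect-≡ {v} {e} eq with em {src e ≡ v}
    ... | yes _ = refl
    ... | no ≢  = contradiction eq ≢

  -- Every path from the root is a play against an opponent who replays it by the clock. Off the
  -- path, `redirect` falls back on some legal edge.
  winning⇒win : ∀ {q} → Winning L σ q → Win (root q)
  winning⇒win {q} winning π = L-≗ (cong col ∘ play≡) (winning σ₂)
    where
    ε = edges π

    σ₂ : Strategy
    σ₂ = record
      { first     = λ v → redirect v (ε 0)
      -- The history `w` followed by `e` has `suc (length w)` edges, which is the index of the next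
      -- edge.
      ; next      = λ w e → redirect (tgt e) (ε (suc (length w)))
      ; src-first = λ v → src-redirect v _
      ; src-next  = λ w e → src-redirect (tgt e) _
      }

    hist = history σ σ₂ q

    length-hist : ∀ i → length (hist i) ≡ i
    length-hist zero    = refl
    length-hist (suc i) = trans (length-++ (hist i))
      (trans (+-comm (length (hist i)) 1) (cong suc (length-hist i)))

    play≡ : ∀ i → play σ σ₂ q i ≡ ε i
    past≡ : ∀ i → past (nodes π i) ≡ hist i

    play≡ zero with legit π 0
    ... | src≡ , own rewrite nodes-zero π = byOwner-≡ q own (sym (redirect-≡ src≡))
    play≡ (suc i) with legit π (suc i)
    ... | src≡ , own rewrite nodes-suc π i | past≡ i | play≡ i | length-hist i =
      byOwner-≡ (tgt (ε i)) own (sym (redirect-≡ src≡))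

    past≡ zero    = cong past (nodes-zero π)
    past≡ (suc i) = trans (cong past (nodes-suc π i))
      (cong₂ (λ w e → w ++ [ e ]) (past≡ i) (sym (play≡ i)))

  -- `wins` is stated for edge sequences instead of plays because their tails are again such
  -- sequences.
  record Solution (Y : Pred V 0ℓ) : Set where
    field
      positional : PositionalStrategy
      invariant  : ∀ e → Consistent positional e → Y (src e) → Y (tgt e)
      wins       : ∀ ε → Linked ε → (∀ i → Consistent positional (ε i)) →
                   Y (src (ε 0)) → L (col ∘ ε)

  -- Enlarging a solved region.

  module Extend (Y : Pred V 0ℓ) (solution : Solution Y) where

    open Solution solution renaming (positional to p)

    -- A breach has at least one edge, so chaining breaches makes progress, and it ends outside `Y`,
    -- where another one can start.
    data Breach (n : Node) : Set where
      now   : ∀ e → Legit n e → ¬ Y (tgt e) → ¬ R (since (ext n e)) → Breach n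
      later : ∀ e → Legit n e → ¬ Y (tgt e) → Breach (ext n e) → Breach n

    Silent : Node → Edge → Set
    Silent n e = Legit n e × col e ∉ S × ¬ Y (tgt e)

    -- The index bounds the number of consecutive silent edges from the node.
    data Soon : ℕ → Node → Set where
      soon : ∀ {m n} →
        (∀ e → Silent n e → ∃[ m′ ] m′ < m × Soon m′ (ext n e)) → Soon m n

    soon-mono : ∀ {m m′ n} → m ≤ m′ → Soon m n → Soon m′ n
    soon-mono m≤m′ (soon h) = soon λ e s → let (l , l<m , s′) = h e s in
      l , <-≤-trans l<m m≤m′ , s′

    soon-suc : ∀ n → (∀ e → Silent n e → ∃[ m ] Soon m (ext n e)) → ∃[ m ] Soon m n
    soon-suc n h = suc (proj₁ bound) , soon λ { (edge _ c v t) s@((refl , _) , _) →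
        proj₁ bound , ≤-refl , All.lookup (proj₂ bound) (∈-cartesianProduct⁺ (∈-allFin c) (∈-allV v)) t s }
      where
      P : ℕ → Fin k × V → Set
      P m (c , v) = ∀ t → let e = edge (here n) c v t in Silent n e → Soon m (ext n e)

      P-some : ∀ cv → ∃[ m ] P m cv
      P-some (c , v) with em {∃[ t ] Silent n (edge (here n) c v t)}
      -- Membership in `δ` has at most one proof, so the bound found for `t` also serves `t′`.
      ... | yes (t , s) = proj₁ (h _ s) , λ t′ _ →
        subst (λ t → Soon _ (ext n (edge (here n) c v t))) (T-irrelevant t t′) (proj₂ (h _ s))
      ... | no ¬s       = 0 , λ t s → contradiction (t , s) ¬s

      bound = bounded P (λ m≤n f t s → soon-mono m≤n (f t s))
        (All.universal P-some (cartesianProduct (allFin k) allV))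

    -- As in König's lemma: a node without a bound has a silent edge to another such node. Iterating
    -- gives a path without letters of `S`, against recurrence.
    win⇒soon : ∀ {n} → Win n → ∃[ m ] Soon m n
    win⇒soon {n} win with em {∃[ m ] Soon m n}
    ... | yes s = s
    ... | no ¬s = contradiction (proj₂ recurs) (proj₁ (proj₂ (proj₁ (proj₂ (step (iter d x))))))
      where
      X = ∃[ n ] ¬ (∃[ m ] Soon m n)

      step : ((n , _) : X) → ∃[ e ] Silent n e × ¬ (∃[ m ] Soon m (ext n e))
      step (n , ¬s) = decidable-stable em λ ¬e →
        ¬s (soon-suc n λ e s → decidable-stable em λ ¬s′ → ¬e (e , s , ¬s′))

      open Iterate {X} proj₁ (proj₁ ∘ step) (λ x → ext (proj₁ x) _ , proj₂ (proj₂ (step x)))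
        (λ x → proj₁ (proj₁ (proj₂ (step x)))) (λ _ → refl)

      x : X
      x = n , ¬s

      recurs = proj₁ (L⇒Recurrent×scan _ (win (path x))) 0
      d = proj₁ recurs

    module AllBreached
      (breach : ∀ n → Win n → ¬ Y (here n) → Breach n) where

      X : Set
      X = Σ[ n ∈ Node ] Win n × Breach n

      move : X → Edge
      move (_ , _ , now e _ _ _)   = e
      move (_ , _ , later e _ _ _) = e

      move-legit : ∀ x → Legit (proj₁ x) (move x)
      move-legit (_ , _ , now _ l _ _)   = l
      move-legit (_ , _ , later _ l _ _) = l

      step : X → X
      step (n , w , now e l y _)   = ext n e , win-ext l w , breach (ext n e) (win-ext l w) y
      step (n , w , later e l _ b) = ext n e , win-ext l w , b

      step-ext : ∀ x → proj₁ (step x) ≡ ext (proj₁ x) (move x)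
      step-ext (_ , _ , now _ _ _ _)   = refl
      step-ext (_ , _ , later _ _ _ _) = refl

      open Iterate {X} proj₁ move step move-legit step-ext

      -- The number of edges before the breaching one, on which `breached` recurses.
      delay : ∀ {n} → Breach n → ℕ
      delay (now _ _ _ _)   = 0
      delay (later _ _ _ b) = suc (delay b)

      delay-zero : ∀ x → delay (proj₂ (proj₂ x)) ≡ 0 → ¬ R (since (proj₁ (step x)))
      delay-zero (_ , _ , now _ _ _ ¬r) _ = ¬r

      delay-suc : ∀ x {d} → delay (proj₂ (proj₂ x)) ≡ suc d → delay (proj₂ (proj₂ (step x))) ≡ d
      delay-suc (_ , _ , later _ _ _ b) eq = suc-injective eq

      breached : ∀ d x → delay (proj₂ (proj₂ x)) ≡ d → ∃[ i ] ¬ R (since (proj₁ (iter (suc i) x)))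
      breached zero    x eq = 0 , delay-zero x eq
      breached (suc d) x eq =
        let i , ¬r = breached d (step x) (delay-suc x eq) in suc i , ¬r

      -- The word of the path lies in `L`, so its scans stay in `R` from some time `t` on; yet the
      -- breach pending at time `t` is completed later.
      absurd : X → ⊥
      absurd x@(n , win , _) = ¬r (subst R
        (trans (Path.scan-word (path x) (t + suc i))
          (cong (λ z → since (proj₁ z)) (iter-+ t (suc i) x)))
        (inR (suc i)))
        where
        scans : ∃[ t ] ∀ i → R (scan (since n) (Path.word (path x)) (t + i))
        scans = proj₂ (L⇒Recurrent×scan _ (win (path x))) (since n)

        t   = proj₁ scans
        inR = proj₂ scans

        breached-later : ∃[ i ] ¬ R (since (proj₁ (iter (suc i) (iter t x))))
        breached-later = breached _ (iter t x) refl

        i  = proj₁ breached-later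
        ¬r = proj₂ breached-later

    ∃-safe : ∀ {n} → Win n → ¬ Y (here n) → ∃[ n′ ] Win n′ × ¬ Y (here n′) × ¬ Breach n′
    ∃-safe {n} win ¬y = decidable-stable em refute
      where
      refute : ¬ ¬ (∃[ n′ ] Win n′ × ¬ Y (here n′) × ¬ Breach n′)
      refute none = AllBreached.absurd breach (n , win , breach n win ¬y)
        where
        breach : ∀ n → Win n → ¬ Y (here n) → Breach n
        breach n w y = decidable-stable em λ ¬b → none (n , w , y , ¬b)

    -- The new positional strategy.

    record Candidate (v : V) : Set where
      field
        node  : Node
        here≡ : here node ≡ v
        win   : Win node
        safe  : ¬ Breach node
        bound : ℕ
        within : Soon bound node

    open Candidate

    key : ∀ {v} → Candidate v → ℕ × ℕ
    key c = rank (since (node c)) , bound c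

    Leader : V → Set
    Leader v = Σ[ c ∈ Candidate v ] (∀ (c′ : Candidate v) → ¬ key c′ ≺ key c)

    candidate : ∀ {n} → Win n → ¬ Breach n → Candidate (here n)
    candidate w ¬b = record
      { node = _ ; here≡ = refl ; win = w ; safe = ¬b
      ; bound = proj₁ (win⇒soon w) ; within = proj₂ (win⇒soon w) }

    Y′ : Pred V 0ℓ
    Y′ = Y ∪ Candidate

    -- The leader is obtained by deciding `Leader v`, not from a given candidate, so the move
    -- depends on `v` alone.
    pick : ∀ v → Dec (Y v) → Dec (Leader v) → Σ[ e ∈ Edge ] src e ≡ v
    pick v (no _) (yes (c , _)) = plan (node c) , trans (src-plan (node c)) (here≡ c)
    pick v _      _             = choose p v , src-choose p v

    p′ : PositionalStrategy
    p′ = record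
      { choose     = λ v → proj₁ (pick v em em)
      ; src-choose = λ v → proj₂ (pick v em em)
      }

    choose-Y : ∀ {v} → Y v → choose p′ v ≡ choose p v
    choose-Y {v} y with em {Y v}
    ... | yes _ = refl
    ... | no ¬y = contradiction y ¬y

    leader : ∀ {v} → ¬ Y v → Candidate v →
      Σ[ l ∈ Leader v ] choose p′ v ≡ plan (node (proj₁ l))
    leader {v} ¬y c with em {Y v} | em {Leader v}
    ... | yes y | _     = contradiction y ¬y
    ... | no _  | yes l = l , refl
    ... | no _  | no ¬l = contradiction (minimal ≺-wellFounded key c) ¬l

    consistent-Y : ∀ e → Consistent p′ e → Y (src e) → Consistent p e
    consistent-Y e con y o = trans (con o) (choose-Y y)

    module Step (e : Edge) (con : Consistent p′ e) (¬ys : ¬ Y (src e)) (c : Candidate (src e)) where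

      led = leader ¬ys c
      lead = proj₁ (proj₁ led)
      n = node lead

      legit-lead : Legit n e
      legit-lead = sym (here≡ lead) ,
        λ o → trans (con (subst Own₁ (here≡ lead) o)) (proj₂ led)

      module _ (¬yt : ¬ Y (tgt e)) where

        R-lead : R (since (ext n e))
        R-lead = decidable-stable em (safe lead ∘ now e legit-lead ¬yt)

        candidate′ : Candidate (tgt e)
        candidate′ = candidate (win-ext legit-lead (win lead)) (safe lead ∘ later e legit-lead ¬yt)

        -- The rank cannot grow by `push-⊑`; if it stays equal, the bound supplied by `Soon` is
        -- smaller.
        closer : col e ∉ S → Σ[ c′ ∈ Candidate (tgt e) ] key c′ ≺ key lead
        closer e∉S with within lead
        ... | soon h with h e (legit-lead , e∉S , ¬yt)
        ...   | m , m<bound , s = record candidate′ { bound = m ; within = s } , lex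
          where
          lex : (rank (since (ext n e)) , m) ≺ key lead
          lex with m≤n⇒m<n∨m≡n (⊑⇒rank≤ {u = since (ext n e)} {v = since n} (push-⊑ e∉S))
          ... | inj₁ lt = inj₁ lt
          ... | inj₂ eq = inj₂ (eq , m<bound)

    invariant′ : ∀ e → Consistent p′ e → Y′ (src e) → Y′ (tgt e)
    invariant′ e con (inj₁ y) = inj₁ (invariant e (consistent-Y e con y) y)
    invariant′ e con (inj₂ c) = go em em
      where
      go : Dec (Y (src e)) → Dec (Y (tgt e)) → Y′ (tgt e)
      -- A state with a candidate may also lie in `Y`, where the old strategy takes precedence.
      go (yes y) _        = inj₁ (invariant e (consistent-Y e con y) y)
      go (no _)  (yes yt) = inj₁ yt
      go (no ¬y) (no ¬yt) = inj₂ (Step.candidate′ e con ¬y c ¬yt)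

    -- Plays of the new strategy.

    module _ (ε : ℕ → Edge) (linked : Linked ε) (con : ∀ i → Consistent p′ (ε i)) where

      wins-Y : Y (src (ε 0)) → L (col ∘ ε)
      wins-Y y = wins ε linked (λ i → consistent-Y (ε i) (con i) (stays i)) y
        where
        stays : ∀ i → Y (src (ε i))
        stays zero    = y
        stays (suc i) = subst Y (sym (linked i))
          (invariant (ε i) (consistent-Y (ε i) (con i) (stays i)) (stays i))

      module _ (¬y : ∀ i → ¬ Y (src (ε i))) (cand : ∀ i → Candidate (src (ε i))) where

        private
          module St i = Step (ε i) (con i) (¬y i) (cand i)
          ν : ℕ → Node
          ν i = St.n i
          κ : ℕ → ℕ × ℕ
          κ i = key (St.lead i)

          ¬yt : ∀ i → ¬ Y (tgt (ε i))
          ¬yt i = subst (¬_ ∘ Y) (linked i) (¬y (suc i))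

          minimal-at : ∀ i (c : Candidate (tgt (ε i))) → ¬ key c ≺ κ (suc i)
          minimal-at i c = proj₂ (proj₁ (St.led (suc i)))
            record { Candidate c ; here≡ = trans (here≡ c) (sym (linked i)) }

        -- The extended node is a candidate at the next state, so the leader there has no larger
        -- rank.
        ν-⊑ : ∀ i → since (ν (suc i)) ⊑ since (ext (ν i) (ε i))
        ν-⊑ i = rank≤⇒⊑ (≮⇒≥ (minimal-at i (St.candidate′ i (¬yt i)) ∘ inj₁))

        κ-decreasing : ∀ i → col (ε i) ∉ S → κ (suc i) ≺ κ i
        κ-decreasing i ∉S with St.closer i (¬yt i) ∉S
        ... | c , c≺ = ≮-≺-trans (minimal-at i c) c≺

        recurrent : Recurrent (col ∘ ε)
        recurrent t = go t (≺-wellFounded (κ t))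
          where
          go : ∀ t → Acc _≺_ (κ t) → ∃[ d ] col (ε (t + d)) ∈ S
          go t (acc rs) with col (ε t) ∈? S
          ... | yes ∈S = 0 , subst (λ i → col (ε i) ∈ S) (sym (+-identityʳ t)) ∈S
          ... | no ∉S with go (suc t) (rs (κ-decreasing t ∉S))
          ...   | d , ∈S = suc d , subst (λ i → col (ε i) ∈ S) (sym (+-suc t d)) ∈S

        ρ : ℕ → List (Fin k)
        ρ = scan (since (ν 0)) (col ∘ ε)

        -- Both words receive the same letter, and `push-mono` keeps the inclusion. Changing to the
        -- next leader only shrinks the imitated residual.
        ν-⊑-ρ : ∀ i → since (ν i) ⊑ ρ i
        ext-⊑-ρ : ∀ i → since (ext (ν i) (ε i)) ⊑ ρ (suc i)

        ν-⊑-ρ zero    = λ r → r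
        ν-⊑-ρ (suc i) = ext-⊑-ρ i ∘ ν-⊑ i
        ext-⊑-ρ i = push-mono (col (ε i)) (ν-⊑-ρ i)

        wins-new : L (col ∘ ε)
        -- The seed makes the real and the imitated word agree at the start. The offset is 1 because
        -- `R-lead` speaks of nodes after an edge.
        wins-new = scan⇒L _ (since (ν 0)) 1 recurrent
          λ i → ⊑-R (ext-⊑-ρ i) (St.R-lead i (¬yt i))

    wins-eventually-Y : ∀ i ε → Linked ε → (∀ j → Consistent p′ (ε j)) → Y (src (ε i)) → L (col ∘ ε)
    wins-eventually-Y zero    ε linked con y = wins-Y ε linked con y
    wins-eventually-Y (suc i) ε linked con y = L-cons _
      (wins-eventually-Y i (ε ∘ suc) (linked ∘ suc) (con ∘ suc) y)

    wins′ : ∀ ε → Linked ε → (∀ i → Consistent p′ (ε i)) → Y′ (src (ε 0)) → L (col ∘ ε)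
    wins′ ε linked con y′ with em {∃[ i ] Y (src (ε i))}
    ... | yes (i , y) = wins-eventually-Y i ε linked con y
    ... | no ¬y       = wins-new ε linked con (λ i y → ¬y (i , y)) cand
      where
      stays : ∀ i → Y′ (src (ε i))
      stays zero    = y′
      stays (suc i) = subst Y′ (sym (linked i)) (invariant′ (ε i) (con i) (stays i))

      cand : ∀ i → Candidate (src (ε i))
      cand i with stays i
      ... | inj₁ y = contradiction (i , y) ¬y
      ... | inj₂ c = c

    -- Iterating the enlargement.

    solution′ : Solution Y′
    solution′ = record { positional = p′ ; invariant = invariant′ ; wins = wins′ }

    -- The state gained is that of the safe node from `∃-safe`, which may differ from `here n`.
    grows : ∀ {n} → Win n → ¬ Y (here n) → count (∁ Y′) allV < count (∁ Y) allV
    grows w ¬y with ∃-safe w ¬y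
    ... | n , win , ¬yn , safe = count-strict (λ ¬y′ → ¬y′ ∘ inj₁) (∈-allV (here n))
      (λ ¬y′ → ¬y′ (inj₂ (candidate win safe))) ¬yn

  solve : ∀ Y → Solution Y → Acc _<_ (count (∁ Y) allV) →
    Σ[ Z ∈ Pred V 0ℓ ] Solution Z × (∀ n → Win n → Z (here n))
  solve Y sol (acc rs) with em {∃[ n ] Win n × ¬ Y (here n)}
  ... | no  all           = Y , sol , λ n w → decidable-stable em λ ¬y → all (n , w , ¬y)
  ... | yes (n , w , ¬y) = solve (Extend.Y′ Y sol) (Extend.solution′ Y sol) (rs (Extend.grows Y sol w ¬y))

  trivial : Solution (λ _ → ⊥)
  trivial = record
    { positional = record { choose = someEdge ; src-choose = src-someEdge }
    ; invariant = λ _ _ ()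
    ; wins = λ _ _ _ ()
    }

  positional-strategy : ∀ (W : Pred V 0ℓ) → (∀ q → W q → Winning L σ q) →
    ∃[ p ] ∀ q → W q → Winning L (toStrategy p) q
  positional-strategy W winning with solve _ trivial (<-wellFounded _)
  ... | Z , sol , total-Z = positional , λ q w σ₂ →
    wins (play (toStrategy positional) σ₂ q) (play-linked positional σ₂ q)
      (play-consistent positional σ₂ q)
      (subst Z (sym (play-src positional σ₂ q)) (total-Z (root q) (winning⇒win (winning q w))))
    where open Solution sol

proposition16 : ExcludedMiddle 0ℓ →
    (k : ℕ) (L : ωLang (Fin k)) (S : Subset k) (R : Lang (Fin k)) →
    R ⊆[∁ S ]* → SubwordClosed R → Regular R → TotallyOrderedResiduals R →
    L ≐ U ·ω (letters S · R) ^ω →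
    PrefixIndependent L × Positional L
proposition16 em k L S R R⊆ closed regular residuals-total L≐ =
  Language.prefixIndependent S R R⊆ closed L L≐ ,
  λ G W σ → Solve.positional-strategy em S R R⊆ closed regular residuals-total L L≐ G σ W
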